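{- Let $(G_1,\prec_1)$ and $(G_2,\prec_2)$ be POP-graphs such that the number of output edges of $G_1$ equals the number of input edges of $G_2$. Then $\prec_2\circ\prec_1$ is a planar order on $G_2\circ G_1$.
   Context: A progressive graph is a finite directed acyclic graph (parallel edges allowed) in which every source and every sink has degree one; degree-one vertices are boundary vertices. An input edge is an edge whose initial vertex is a boundary vertex; an output edge one whose terminal vertex is a boundary vertex. For edges write $e\to e'$ if $e\neq e'$ and there is a directed path whose first edge is $e$ and last edge is $e'$. A planar order on $G$ is a linear order $\prec$ on $E(G)$ such that (P1) $e_1\to e_2$ implies $e_1\prec e_2$; (P2) if $e_1\prec e_2\prec e_3$ and $e_1\to e_3$ then $e_1\to e_2$ or $e_2\to e_3$. A POP-graph is a progressive graph with a planar order. Composition: let $(G_1,\prec_1)$, $(G_2,\prec_2)$ be POP-graphs, $G_1$ with output edges $o_1\prec_1\cdots\prec_1 o_n$ and $G_2$ with input edges $i_1\prec_2\cdots\prec_2 i_n$. The progressive graph $G_2\circ G_1$ is obtained from $G_1\sqcup G_2$ by deleting the sinks of $G_1$, the sources of $G_2$ and the edges $o_k,i_k$, and adding for each $k$ a new edge $\overline{e_k}$ from the initial vertex of $o_k$ to the terminal vertex of $i_k$. Let $Q_1=\{e\in E(G_1): e\prec_1 o_1\}$, $Q_k=\{e: o_{k-1}\prec_1 e\prec_1 o_k\}$ ($2\le k\le n$), $P_k=\{e\in E(G_2): i_k\prec_2 e\prec_2 i_{k+1}\}$ ($1\le k\le n-1$), $P_n=\{e: i_n\prec_2 e\}$. The composition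 $\prec_2\circ\prec_1$ is the linear order on $E(G_2\circ G_1)$ listing $Q_1,\{\overline{e_1}\},P_1,Q_2,\{\overline{e_2}\},P_2,\dots,Q_n,\{\overline{e_n}\},P_n$ consecutively, each $Q_k$ ordered by $\prec_1$ and each $P_k$ by $\prec_2$. -}

module Defs where

open import Axiom.UniquenessOfIdentityProofs.WithK using (uip)
open import Data.Empty using (⊥; ⊥-elim)
open import Data.Fin.Base as Fin using (Fin; zero; suc; toℕ)
import Data.Fin.Properties as Fin
open import Data.List.Base using (List; []; _∷_; length; lookup; tabulate)
open import Data.List.Membership.Propositional using (_∈_)
open import Data.List.Membership.Propositional.Properties using (∈-lookup; ∈-tabulate⁺)
open import Data.List.Properties using (length-tabulate)
open import Data.List.Relation.Binary.Permutation.Propositional using (↭-sym; ↭⇒↭ₛ)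
open import Data.List.Relation.Binary.Permutation.Propositional.Properties
  using (∈-resp-↭; ↭-length)
import Data.List.Relation.Binary.Permutation.Setoid.Properties as ↭ₛ
import Data.List.Relation.Unary.All as All
open import Data.List.Relation.Unary.AllPairs as AllPairs using (AllPairs; []; _∷_)
open import Data.List.Relation.Unary.Any using (index)
open import Data.List.Relation.Unary.Any.Properties using (lookup-index)
import Data.List.Relation.Unary.Sorted.TotalOrder.Properties as Sorted
open import Data.List.Relation.Unary.Unique.Propositional.Properties using (tabulate⁺)
import Data.List.Sort as Sort
open import Data.Nat.Base using (ℕ; zero; suc; s<s)
import Data.Nat.Properties as ℕ
open import Data.Product.Base using (Σ; ∃; ∃-syntax; _×_; _,_; proj₁; proj₂)
open import Data.Product.Relation.Binary.Lex.Strict using (×-Lex)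
open import Data.Sum.Base using (_⊎_; inj₁; inj₂)
open import Data.Sum.Function.Propositional using (_⊎-↔_)
open import Data.Sum.Properties using (inj₁-injective; inj₂-injective)
open import Function.Base using (_∘_; _on_)
open import Function.Bundles using (_↔_; mk↔ₛ′; module Injection; module Inverse)
open import Function.Construct.Composition using (_↔-∘_)
open import Function.Construct.Symmetry using (↔-sym)
open import Function.Properties.Inverse using (↔⇒↣; ↔-refl)
open import Level using (0ℓ)
open import Relation.Binary.Bundles using (StrictTotalOrder)
open import Relation.Binary.Construct.Closure.ReflexiveTransitive using (Star; ε; _◅_)
open import Relation.Binary.Core using (Rel)
open import Relation.Binary.Definitions using (DecidableEquality; Tri; tri<; tri≈; tri>)
open import Relation.Binary.PropositionalEquality
  using (_≡_; _≢_; refl; sym; trans; cong; subst; setoid; isEquivalence)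
import Relation.Binary.Properties.StrictTotalOrder as STO
open import Relation.Binary.Structures using (IsStrictTotalOrder)
open import Relation.Nullary using (¬_; Dec; yes; no)
import Relation.Nullary.Decidable as Dec
open import Relation.Nullary.Decidable using (via-injection; ¬?)
open import Relation.Unary using (Pred; Decidable; Irrelevant)

IsFinite : Set → Set
IsFinite A = ∃[ n ] (A ↔ Fin n)

card : {A : Set} → IsFinite A → ℕ
card = proj₁

finite-≟ : {A : Set} → IsFinite A → DecidableEquality A
finite-≟ (_ , f) = via-injection (↔⇒↣ f) Fin._≟_

finite-any? : {A : Set} → IsFinite A → {P : Pred A 0ℓ} → Decidable P → Dec (∃ P)
finite-any? (_ , f) {P} P? =
  Dec.map′ (λ (k , p) → from k , p)
           (λ (a , p) → to a , subst P (sym (strictlyInverseʳ a)) p)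
           (Fin.any? (P? ∘ from))
  where open Inverse f

finite-⊎ : {A B : Set} → IsFinite A → IsFinite B → IsFinite (A ⊎ B)
finite-⊎ (_ , f) (_ , g) = _ , (↔-sym Fin.+↔⊎ ↔-∘ (f ⊎-↔ g))

Σ-≡ : {A : Set} {P : Pred A 0ℓ} → Irrelevant P →
      {x y : Σ A P} → proj₁ x ≡ proj₁ y → x ≡ y
Σ-≡ irr {x , p} {.x , q} refl = cong (x ,_) (irr p q)

finite-ΣFin : ∀ n {P : Pred (Fin n) 0ℓ} → Decidable P → Irrelevant P →
              IsFinite (Σ (Fin n) P)
finite-ΣFin zero P? irr =
  0 , mk↔ₛ′ (λ { (() , _) }) (λ ()) (λ ()) (λ { (() , _) })
finite-ΣFin (suc n) {P} P? irr
  with P? zero | finite-ΣFin n {P ∘ suc} (P? ∘ suc) irr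
... | yes p | m , f = suc m , mk↔ₛ′ to′ from′ to-from from-to
  where
  open Inverse f
  to′ : Σ (Fin (suc n)) P → Fin (suc m)
  to′ (zero  , _) = zero
  to′ (suc k , q) = suc (to (k , q))
  from′ : Fin (suc m) → Σ (Fin (suc n)) P
  from′ zero    = zero , p
  from′ (suc j) = suc (proj₁ (from j)) , proj₂ (from j)
  to-from : ∀ j → to′ (from′ j) ≡ j
  to-from zero    = refl
  to-from (suc j) = cong suc (strictlyInverseˡ j)
  from-to : ∀ x → from′ (to′ x) ≡ x
  from-to (zero  , _) = Σ-≡ irr refl
  from-to (suc k , q) = Σ-≡ irr (cong (suc ∘ proj₁) (strictlyInverseʳ (k , q)))
... | no ¬p | m , f = m , mk↔ₛ′ to′ from′ strictlyInverseˡ from-to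
  where
  open Inverse f
  to′ : Σ (Fin (suc n)) P → Fin m
  to′ (zero  , q) = ⊥-elim (¬p q)
  to′ (suc k , q) = to (k , q)
  from′ : Fin m → Σ (Fin (suc n)) P
  from′ j = suc (proj₁ (from j)) , proj₂ (from j)
  from-to : ∀ x → from′ (to′ x) ≡ x
  from-to (zero  , q) = ⊥-elim (¬p q)
  from-to (suc k , q) = Σ-≡ irr (cong (suc ∘ proj₁) (strictlyInverseʳ (k , q)))

finite-Σ : {A : Set} → IsFinite A → {P : Pred A 0ℓ} →
           Decidable P → Irrelevant P → IsFinite (Σ A P)
finite-Σ {A} (n , f) {P} P? irr = m , (g ↔-∘ reindex)
  where
  open Inverse f
  m = proj₁ (finite-ΣFin n (P? ∘ from) irr)
  g = proj₂ (finite-ΣFin n (P? ∘ from) irr)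
  reindex : Σ A P ↔ Σ (Fin n) (P ∘ from)
  reindex = mk↔ₛ′
    (λ (a , p) → to a , subst P (sym (strictlyInverseʳ a)) p)
    (λ (k , p) → from k , p)
    (λ (k , _) → Σ-≡ irr (strictlyInverseˡ k))
    (λ (a , _) → Σ-≡ irr (strictlyInverseʳ a))

card≡1⇒unique : {A : Set} (fin : IsFinite A) → card fin ≡ 1 → (x y : A) → x ≡ y
card≡1⇒unique (.1 , f) refl x y = Injection.injective (↔⇒↣ f) (Fin1 _ _)
  where
  Fin1 : (j k : Fin 1) → j ≡ k
  Fin1 zero zero = refl

card≡1⇒inhabited : {A : Set} (fin : IsFinite A) → card fin ≡ 1 → A
card≡1⇒inhabited (.1 , f) refl = Inverse.from f zero

unique⇒card≡1 : {A : Set} (fin : IsFinite A) → A → ((x y : A) → x ≡ y) → card fin ≡ 1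
unique⇒card≡1 (zero , f) a _ with () ← Inverse.to f a
unique⇒card≡1 (suc zero , f) _ _ = refl
unique⇒card≡1 (suc (suc n) , f) _ u
  with () ← Injection.injective (↔⇒↣ (↔-sym f)) {zero} {suc zero} (u _ _)

record SortedEnumeration {A : Set} (_<_ : Rel A 0ℓ) (n : ℕ) : Set where
  field
    at         : Fin n → A
    increasing : ∀ {j k} → j Fin.< k → at j < at k
    surjective : ∀ a → ∃[ k ] at k ≡ a

AllPairs-lookup : {A : Set} {R : Rel A 0ℓ} {xs : List A} → AllPairs R xs →
                  ∀ {j k} → j Fin.< k → R (lookup xs j) (lookup xs k)
AllPairs-lookup (px ∷ _)   {zero}  {suc k} _         = All.lookup px (∈-lookup k)
AllPairs-lookup (_  ∷ pxs) {suc j} {suc k} (s<s j<k) = AllPairs-lookup pxs j<k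

enumerate : {A : Set} {_<_ : Rel A 0ℓ} (fin : IsFinite A) →
            IsStrictTotalOrder _≡_ _<_ → SortedEnumeration _<_ (card fin)
enumerate {A} {_<_} (n , f) isSTO = subst (SortedEnumeration _<_) length-xs record
  { at         = lookup xs
  ; increasing = AllPairs-lookup xs-strict
  ; surjective = λ a → index (a∈xs a) , sym (lookup-index (a∈xs a))
  }
  where
  open Inverse f
  sto : StrictTotalOrder 0ℓ 0ℓ 0ℓ
  sto = record { isStrictTotalOrder = isSTO }
  module S = Sort (STO.decTotalOrder sto)

  ys xs : List A
  ys = tabulate from
  xs = S.sort ys

  length-xs : length xs ≡ n
  length-xs = trans (↭-length (S.sort-↭ ys)) (length-tabulate from)

  a∈xs : ∀ a → a ∈ xs
  a∈xs a = ∈-resp-↭ (↭-sym (S.sort-↭ ys))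
             (subst (_∈ ys) (strictlyInverseʳ a) (∈-tabulate⁺ (to a)))

  strict : ∀ {x y} → (x < y ⊎ x ≡ y) × x ≢ y → x < y
  strict (inj₁ x<y , _)   = x<y
  strict (inj₂ x≡y , x≢y) = ⊥-elim (x≢y x≡y)

  xs-strict : AllPairs _<_ xs
  xs-strict = AllPairs.zipWith strict
    ( Sorted.Sorted⇒AllPairs (STO.totalOrder sto) (S.sort-↗ ys)
    , ↭ₛ.Unique-resp-↭ (setoid A) (↭⇒↭ₛ (↭-sym (S.sort-↭ ys)))
        (tabulate⁺ (Injection.injective (↔⇒↣ (↔-sym f)))))

record Graph : Set₁ where
  field
    V E     : Set
    src tgt : E → V
    finiteV : IsFinite V
    finiteE : IsFinite E

  IsSource IsSink : V → Set
  IsSource v = ∀ e → tgt e ≢ v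
  IsSink   v = ∀ e → src e ≢ v

  -- A loop at v contributes two half-edges.
  HalfEdge : V → Set
  HalfEdge v = (Σ E λ e → src e ≡ v) ⊎ (Σ E λ e → tgt e ≡ v)

  finiteHalfEdge : ∀ v → IsFinite (HalfEdge v)
  finiteHalfEdge v = finite-⊎
    (finite-Σ finiteE (λ e → finite-≟ finiteV (src e) v) uip)
    (finite-Σ finiteE (λ e → finite-≟ finiteV (tgt e) v) uip)

  degree : V → ℕ
  degree v = card (finiteHalfEdge v)

  IsBoundary : V → Set
  IsBoundary v = degree v ≡ 1

  IsInput IsOutput : E → Set
  IsInput  e = IsBoundary (src e)
  IsOutput e = IsBoundary (tgt e)

  Consecutive : Rel E 0ℓ
  Consecutive e e′ = tgt e ≡ src e′

  -- The directed paths with first edge e and last edge e′.  The reflexive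
  -- case is the path consisting of a single edge.
  Path : Rel E 0ℓ
  Path = Star Consecutive

  Acyclic : Set
  Acyclic = ∀ {e e′} → Path e e′ → tgt e′ ≢ src e

  infix 4 _⟶_
  _⟶_ : Rel E 0ℓ
  e ⟶ e′ = e ≢ e′ × Path e e′

  isSource? : Decidable IsSource
  isSource? v = Dec.map′ (λ ¬h e p → ¬h (e , p)) (λ s (e , p) → s e p)
    (¬? (finite-any? finiteE (λ e → finite-≟ finiteV (tgt e) v)))

  isSink? : Decidable IsSink
  isSink? v = Dec.map′ (λ ¬h e p → ¬h (e , p)) (λ s (e , p) → s e p)
    (¬? (finite-any? finiteE (λ e → finite-≟ finiteV (src e) v)))

  isInput? : Decidable IsInput
  isInput? e = degree (src e) ℕ.≟ 1

  isOutput? : Decidable IsOutput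
  isOutput? e = degree (tgt e) ℕ.≟ 1

  InputEdge OutputEdge : Set
  InputEdge  = Σ E IsInput
  OutputEdge = Σ E IsOutput

  finiteInputEdge : IsFinite InputEdge
  finiteInputEdge = finite-Σ finiteE isInput? uip

  finiteOutputEdge : IsFinite OutputEdge
  finiteOutputEdge = finite-Σ finiteE isOutput? uip

record ProgressiveGraph : Set₁ where
  field
    graph : Graph
  open Graph graph public
  field
    acyclic       : Acyclic
    source-degree : ∀ {v} → IsSource v → degree v ≡ 1
    sink-degree   : ∀ {v} → IsSink v → degree v ≡ 1

record IsPlanarOrder (G : ProgressiveGraph)
                     (_≺_ : Rel (ProgressiveGraph.E G) 0ℓ) : Set where
  open ProgressiveGraph G using (_⟶_)
  field
    isStrictTotalOrder : IsStrictTotalOrder _≡_ _≺_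
    P1 : ∀ {e₁ e₂} → e₁ ⟶ e₂ → e₁ ≺ e₂
    P2 : ∀ {e₁ e₂ e₃} → e₁ ≺ e₂ → e₂ ≺ e₃ → e₁ ⟶ e₃ → e₁ ⟶ e₂ ⊎ e₂ ⟶ e₃

restrict : {A : Set} {P : Pred A 0ℓ} {_<_ : Rel A 0ℓ} → Irrelevant P →
           IsStrictTotalOrder _≡_ _<_ →
           IsStrictTotalOrder {A = Σ A P} _≡_ (_<_ on proj₁)
restrict {P = P} {_<_} irr sto = record
  { isStrictPartialOrder = record
    { isEquivalence = isEquivalence
    ; irrefl        = λ { refl → irrefl refl }
    ; trans         = S.trans
    ; <-resp-≈      = (λ { refl p → p }) , (λ { refl p → p })
    }
  ; compare = cmp
  }
  where
  module S = IsStrictTotalOrder sto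
  open S using (irrefl)
  cmp : ∀ x y → Tri (proj₁ x < proj₁ y) (x ≡ y) (proj₁ y < proj₁ x)
  cmp x y with S.compare (proj₁ x) (proj₁ y)
  ... | tri< a b c = tri< a (b ∘ cong proj₁) c
  ... | tri≈ a b c = tri≈ a (Σ-≡ irr b) c
  ... | tri> a b c = tri> a (b ∘ cong proj₁) c

record POPGraph : Set₁ where
  field
    progressiveGraph : ProgressiveGraph
  open ProgressiveGraph progressiveGraph public
  infix 4 _≺_
  field
    _≺_           : Rel E 0ℓ
    isPlanarOrder : IsPlanarOrder progressiveGraph _≺_
  open IsPlanarOrder isPlanarOrder public

  numInputs numOutputs : ℕ
  numInputs  = card finiteInputEdge
  numOutputs = card finiteOutputEdge

  SortedInputs SortedOutputs : ℕ → Set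
  SortedInputs  = SortedEnumeration {InputEdge}  (_≺_ on proj₁)
  SortedOutputs = SortedEnumeration {OutputEdge} (_≺_ on proj₁)

  sortedInputs : SortedInputs numInputs
  sortedInputs = enumerate finiteInputEdge (restrict uip isStrictTotalOrder)

  sortedOutputs : SortedOutputs numOutputs
  sortedOutputs = enumerate finiteOutputEdge (restrict uip isStrictTotalOrder)

increasing⇒injective : {A : Set} {_<_ : Rel A 0ℓ} {n : ℕ} →
  (∀ {x} → ¬ (x < x)) → (s : SortedEnumeration _<_ n) →
  let open SortedEnumeration s in ∀ {j k} → at j ≡ at k → j ≡ k
increasing⇒injective {_<_ = _<_} irr s {j} {k} eq with Fin.<-cmp j k
... | tri< j<k _ _ = ⊥-elim (irr (subst (_< at k) eq (increasing j<k)))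
  where open SortedEnumeration s
... | tri≈ _ j≡k _ = j≡k
... | tri> _ _ k<j = ⊥-elim (irr (subst (at k <_) eq (increasing k<j)))
  where open SortedEnumeration s

module Composition (P₁ P₂ : POPGraph) {n : ℕ}
                   (outputs : POPGraph.SortedOutputs P₁ n)
                   (inputs  : POPGraph.SortedInputs  P₂ n) where

  private
    module G₁ = POPGraph P₁
    module G₂ = POPGraph P₂
    module O = SortedEnumeration outputs
    module I = SortedEnumeration inputs

  o : Fin n → G₁.E
  o k = proj₁ (O.at k)

  i : Fin n → G₂.E
  i k = proj₁ (I.at k)

  Vertex : Set
  Vertex = Σ G₁.V (¬_ ∘ G₁.IsSink) ⊎ Σ G₂.V (¬_ ∘ G₂.IsSource)

  -- The middle summand consists of the new edges joining o k to i k.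
  Edge : Set
  Edge = Σ G₁.E (¬_ ∘ G₁.IsOutput) ⊎ Fin n ⊎ Σ G₂.E (¬_ ∘ G₂.IsInput)

  pattern old₁ e ¬out = inj₁ (e , ¬out)
  pattern new k       = inj₂ (inj₁ k)
  pattern old₂ e ¬in  = inj₂ (inj₂ (e , ¬in))

  source target : Edge → Vertex
  source (old₁ e _)    = inj₁ (G₁.src e , λ sink → sink e refl)
  source (new k)       = inj₁ (G₁.src (o k) , λ sink → sink (o k) refl)
  source (old₂ e ¬in)  = inj₂ (G₂.src e , ¬in ∘ G₂.source-degree)
  target (old₁ e ¬out) = inj₁ (G₁.tgt e , ¬out ∘ G₁.sink-degree)
  target (new k)       = inj₂ (G₂.tgt (i k) , λ source → source (i k) refl)
  target (old₂ e _)    = inj₂ (G₂.tgt e , λ source → source e refl)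

  composedGraph : Graph
  composedGraph = record
    { V = Vertex
    ; E = Edge
    ; src = source
    ; tgt = target
    ; finiteV = finite-⊎ (finite-Σ G₁.finiteV (¬? ∘ G₁.isSink?) (λ _ _ → refl))
                         (finite-Σ G₂.finiteV (¬? ∘ G₂.isSource?) (λ _ _ → refl))
    ; finiteE = finite-⊎ (finite-Σ G₁.finiteE (¬? ∘ G₁.isOutput?) (λ _ _ → refl))
                (finite-⊎ (n , ↔-refl)
                          (finite-Σ G₂.finiteE (¬? ∘ G₂.isInput?) (λ _ _ → refl)))
    }

  module C = Graph composedGraph

  path-to-old₁ : ∀ {x e′ ¬out′} → C.Path x (old₁ e′ ¬out′) →
                 ∃[ e ] ∃[ ¬out ] x ≡ old₁ e ¬out × G₁.Path e e′
  path-to-old₁ ε = _ , _ , refl , ε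
  path-to-old₁ (_◅_ {i = x} c p) with x | path-to-old₁ p
  ... | old₁ e ¬out | _ , _ , refl , q =
    e , ¬out , refl , cong proj₁ (inj₁-injective c) ◅ q
  ... | new _       | _ , _ , refl , _ with () ← c
  ... | old₂ _ _    | _ , _ , refl , _ with () ← c

  path-from-old₂ : ∀ {e ¬in y} → C.Path (old₂ e ¬in) y →
                   ∃[ e′ ] ∃[ ¬in′ ] y ≡ old₂ e′ ¬in′ × G₂.Path e e′
  path-from-old₂ ε = _ , _ , refl , ε
  path-from-old₂ (_◅_ {j = old₁ _ _} () p)
  path-from-old₂ (_◅_ {j = new _} () p)
  path-from-old₂ (_◅_ {j = old₂ _ _} c p) with path-from-old₂ p
  ... | _ , _ , refl , q = _ , _ , refl , cong proj₁ (inj₂-injective c) ◅ q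

  acyclic : C.Acyclic
  acyclic {e′ = old₁ _ _} p closed with path-to-old₁ p
  ... | _ , _ , refl , q = G₁.acyclic q (cong proj₁ (inj₁-injective closed))
  acyclic {e = old₁ _ _} {e′ = new _} p ()
  acyclic {e = new _}    {e′ = new _} p ()
  acyclic {e = old₁ _ _} {e′ = old₂ _ _} p ()
  acyclic {e = new _}    {e′ = old₂ _ _} p ()
  acyclic {e = old₂ _ _} p closed with path-from-old₂ p
  ... | _ , _ , refl , q = G₂.acyclic q (cong proj₁ (inj₂-injective closed))

  o-injective : ∀ {j k} → o j ≡ o k → j ≡ k
  o-injective =
    increasing⇒injective (IsStrictTotalOrder.irrefl G₁.isStrictTotalOrder refl) outputs
    ∘ Σ-≡ uip

  i-injective : ∀ {j k} → i j ≡ i k → j ≡ k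
  i-injective =
    increasing⇒injective (IsStrictTotalOrder.irrefl G₂.isStrictTotalOrder refl) inputs
    ∘ Σ-≡ uip

  edge-from : ∀ e ¬sink → ∃[ x ] source x ≡ inj₁ (G₁.src e , ¬sink)
  edge-from e ¬sink with G₁.isOutput? e
  ... | no ¬out = old₁ e ¬out , refl
  ... | yes out with O.surjective (e , out)
  ...   | k , eq = new k , cong inj₁ (Σ-≡ (λ _ _ → refl) (cong (G₁.src ∘ proj₁) eq))

  edge-to : ∀ e ¬source → ∃[ x ] target x ≡ inj₂ (G₂.tgt e , ¬source)
  edge-to e ¬source with G₂.isInput? e
  ... | no ¬in = old₂ e ¬in , refl
  ... | yes inp with I.surjective (e , inp)
  ...   | k , eq = new k , cong inj₂ (Σ-≡ (λ _ _ → refl) (cong (G₂.tgt ∘ proj₁) eq))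

  source-in-G₁ : ∀ {v ¬sink} → C.IsSource (inj₁ (v , ¬sink)) → G₁.IsSource v
  source-in-G₁ {v} {¬sink} src e refl = src (old₁ e ¬out) refl
    where
    two : G₁.IsOutput e → ∀ e′ → G₁.src e′ ≢ v
    two out e′ eq with () ← card≡1⇒unique (G₁.finiteHalfEdge v) out
                              (inj₁ (e′ , eq)) (inj₂ (e , refl))
    ¬out : ¬ G₁.IsOutput e
    ¬out out = ¬sink (two out)

  sink-in-G₂ : ∀ {v ¬source} → C.IsSink (inj₂ (v , ¬source)) → G₂.IsSink v
  sink-in-G₂ {v} {¬source} snk e refl = snk (old₂ e ¬in) refl
    where
    two : G₂.IsInput e → ∀ e′ → G₂.tgt e′ ≢ v
    two inp e′ eq with () ← card≡1⇒unique (G₂.finiteHalfEdge v) inp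
                              (inj₁ (e , refl)) (inj₂ (e′ , eq))
    ¬in : ¬ G₂.IsInput e
    ¬in inp = ¬source (two inp)

  -- The new edges are sent to their G₁-halves by over₁ and to their
  -- G₂-halves by over₂.
  over₁ : Edge → G₁.E ⊎ G₂.E
  over₁ (old₁ e _) = inj₁ e
  over₁ (new k)    = inj₁ (o k)
  over₁ (old₂ e _) = inj₂ e

  over₁-injective : ∀ {x y} → over₁ x ≡ over₁ y → x ≡ y
  over₁-injective {old₁ _ _}    {old₁ _ _}    refl = refl
  over₁-injective {old₁ _ ¬out} {new k}       refl = ⊥-elim (¬out (proj₂ (O.at k)))
  over₁-injective {new k}       {old₁ _ ¬out} refl = ⊥-elim (¬out (proj₂ (O.at k)))
  over₁-injective {new _}       {new _}       eq   =
    cong new′ (o-injective (inj₁-injective eq))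
    where new′ = λ k → new k
  over₁-injective {old₂ _ _}    {old₂ _ _}    refl = refl

  over₂ : Edge → G₁.E ⊎ G₂.E
  over₂ (old₁ e _) = inj₁ e
  over₂ (new k)    = inj₂ (i k)
  over₂ (old₂ e _) = inj₂ e

  over₂-injective : ∀ {x y} → over₂ x ≡ over₂ y → x ≡ y
  over₂-injective {old₁ _ _}   {old₁ _ _}   refl = refl
  over₂-injective {old₂ _ ¬in} {new k}      refl = ⊥-elim (¬in (proj₂ (I.at k)))
  over₂-injective {new k}      {old₂ _ ¬in} refl = ⊥-elim (¬in (proj₂ (I.at k)))
  over₂-injective {new _}      {new _}      eq   =
    cong new′ (i-injective (inj₂-injective eq))
    where new′ = λ k → new k
  over₂-injective {old₂ _ _}   {old₂ _ _}   refl = refl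
  over₂-injective {old₁ _ _}   {new _}      ()
  over₂-injective {old₁ _ _}   {old₂ _ _}   ()

  lift₁ : ∀ {v ¬sink} x → source x ≡ inj₁ (v , ¬sink) →
          Σ G₁.E λ e → over₁ x ≡ inj₁ e × G₁.src e ≡ v
  lift₁ (old₁ e _) refl = e , refl , refl
  lift₁ (new k)    refl = o k , refl , refl

  lift₂ : ∀ {v ¬source} x → target x ≡ inj₂ (v , ¬source) →
          Σ G₂.E λ e → over₂ x ≡ inj₂ e × G₂.tgt e ≡ v
  lift₂ (new k)    refl = i k , refl , refl
  lift₂ (old₂ e _) refl = e , refl , refl

  source-degree : ∀ {v} → C.IsSource v → C.degree v ≡ 1
  source-degree {inj₁ (v , ¬sink)} src =
    unique⇒card≡1 (C.finiteHalfEdge _) half unique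
    where
    deg : G₁.degree v ≡ 1
    deg = G₁.source-degree (source-in-G₁ src)

    half : C.HalfEdge (inj₁ (v , ¬sink))
    half with card≡1⇒inhabited (G₁.finiteHalfEdge v) deg
    ... | inj₁ (e , refl) = inj₁ (edge-from e ¬sink)
    ... | inj₂ (e , eq)   = ⊥-elim (source-in-G₁ src e eq)

    unique : (h h′ : C.HalfEdge (inj₁ (v , ¬sink))) → h ≡ h′
    unique (inj₂ (x , p)) _ = ⊥-elim (src x p)
    unique (inj₁ _) (inj₂ (x , p)) = ⊥-elim (src x p)
    unique (inj₁ (x , p)) (inj₁ (y , q)) with lift₁ x p | lift₁ y q
    ... | e , x↦e , p′ | e′ , y↦e′ , q′
      with refl ← card≡1⇒unique (G₁.finiteHalfEdge v) deg
                    (inj₁ (e , p′)) (inj₁ (e′ , q′))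
      = cong inj₁ (Σ-≡ uip (over₁-injective (trans x↦e (sym y↦e′))))
  source-degree {inj₂ (v , ¬source)} src =
    ⊥-elim (¬source λ { e refl → let x , p = edge-to e ¬source in src x p })

  sink-degree : ∀ {v} → C.IsSink v → C.degree v ≡ 1
  sink-degree {inj₁ (v , ¬sink)} snk =
    ⊥-elim (¬sink λ { e refl → let x , p = edge-from e ¬sink in snk x p })
  sink-degree {inj₂ (v , ¬source)} snk =
    unique⇒card≡1 (C.finiteHalfEdge _) half unique
    where
    deg : G₂.degree v ≡ 1
    deg = G₂.sink-degree (sink-in-G₂ snk)

    half : C.HalfEdge (inj₂ (v , ¬source))
    half with card≡1⇒inhabited (G₂.finiteHalfEdge v) deg
    ... | inj₂ (e , refl) = inj₂ (edge-to e ¬source)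
    ... | inj₁ (e , eq)   = ⊥-elim (sink-in-G₂ snk e eq)

    unique : (h h′ : C.HalfEdge (inj₂ (v , ¬source))) → h ≡ h′
    unique (inj₁ (x , p)) _ = ⊥-elim (snk x p)
    unique (inj₂ _) (inj₁ (x , p)) = ⊥-elim (snk x p)
    unique (inj₂ (x , p)) (inj₂ (y , q)) with lift₂ x p | lift₂ y q
    ... | e , x↦e , p′ | e′ , y↦e′ , q′
      with refl ← card≡1⇒unique (G₂.finiteHalfEdge v) deg
                    (inj₂ (e , p′)) (inj₂ (e′ , q′))
      = cong inj₂ (Σ-≡ uip (over₂-injective (trans x↦e (sym y↦e′))))

  composite : ProgressiveGraph
  composite = record
    { graph         = composedGraph
    ; acyclic       = acyclic
    ; source-degree = λ {v} → source-degree {v}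
    ; sink-degree   = λ {v} → sink-degree {v}
    }

  -- Q k = { e : o (k-1) ≺₁ e ≺₁ o k }, without the lower bound for the first k.
  Q : Fin n → Pred G₁.E 0ℓ
  Q k e = (∀ j → suc (toℕ j) ≡ toℕ k → o j G₁.≺ e) × e G₁.≺ o k

  -- P k = { e : i k ≺₂ e ≺₂ i (k+1) }, without the upper bound for the last k.
  P : Fin n → Pred G₂.E 0ℓ
  P k e = i k G₂.≺ e × (∀ j → toℕ j ≡ suc (toℕ k) → e G₂.≺ i j)

  -- Q k, { new k } and P k are the blocks (k , 0), (k , 1) and (k , 2); the
  -- lexicographic order on indices lists them as Q₁, {e₁}, P₁, Q₂, {e₂}, P₂, ….
  BlockIndex : Set
  BlockIndex = Fin n × Fin 3

  infix 4 _∈Block_ _<ᵇ_ _≺∘_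
  data _∈Block_ : Edge → BlockIndex → Set where
    inQ   : ∀ {k e ¬out} → Q k e → old₁ e ¬out ∈Block (k , zero)
    isNew : ∀ {k} → new k ∈Block (k , suc zero)
    inP   : ∀ {k e ¬in} → P k e → old₂ e ¬in ∈Block (k , suc (suc zero))

  _<ᵇ_ : Rel BlockIndex 0ℓ
  _<ᵇ_ = ×-Lex _≡_ Fin._<_ Fin._<_

  data _≺∘_ : Rel Edge 0ℓ where
    between : ∀ {x y b c} → x ∈Block b → y ∈Block c → b <ᵇ c → x ≺∘ y
    withinQ : ∀ {k e e′ ¬out ¬out′} → Q k e → Q k e′ → e G₁.≺ e′ →
              old₁ e ¬out ≺∘ old₁ e′ ¬out′
    withinP : ∀ {k e e′ ¬in ¬in′} → P k e → P k e′ → e G₂.≺ e′ →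
              old₂ e ¬in ≺∘ old₂ e′ ¬in′

module _ (P₂ P₁ : POPGraph)
         (eq : POPGraph.numOutputs P₁ ≡ POPGraph.numInputs P₂) where

  private
    module C = Composition P₁ P₂
      (POPGraph.sortedOutputs P₁)
      (subst (POPGraph.SortedInputs P₂) (sym eq) (POPGraph.sortedInputs P₂))

  compositeGraph : ProgressiveGraph
  compositeGraph = C.composite

  compositeOrder : Rel (ProgressiveGraph.E compositeGraph) 0ℓ
  compositeOrder = C._≺∘_

{-# OPTIONS --safe #-}

-- Every edge of G₁ reaches an output and every edge of G₂ is reached from an
-- input, so the blocks Q k and P k cover all old edges and ≺₂∘≺₁ is a strict
-- total order; it restricts to ≺₁ on the lower edges (old edges of G₁ and new
-- edges) and to ≺₂ on the upper ones.  Since no path leads from one output (or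
-- input) to another, (P2) for G₁ and G₂ gives e → o k for every e in Q k and
-- i k → e for every e in P k.  For (P2) in the composite, a path from G₁ to G₂
-- crosses some new edge, and an edge y off the side of the path under
-- consideration is replaced by the new edge of its block, which is joined to y.
module Submission where

open import Defs
open import Data.Empty using (⊥-elim)
open import Data.Fin.Base as Fin using (Fin; zero; suc; toℕ; fromℕ<)
import Data.Fin.Induction as Fin
import Data.Fin.Properties as Fin
import Data.Nat.Base as ℕ
import Data.Nat.Properties as ℕ
open import Data.Product.Base using (∃; ∃-syntax; _×_; _,_; proj₁; proj₂)
open import Data.Product.Relation.Binary.Lex.Strict using (×-isStrictTotalOrder)
open import Data.Sum.Base as Sum using (_⊎_; inj₁; inj₂)
open import Data.Sum.Properties using (inj₁-injective; inj₂-injective)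
open import Function.Base using (_∘_; flip; id)
open import Function.Bundles using (module Inverse)
open import Induction.WellFounded using (WellFounded; Acc; acc; module Subrelation)
open import Level using (0ℓ)
open import Relation.Binary.Construct.Closure.ReflexiveTransitive using (ε; _◅_; _◅◅_)
import Relation.Binary.Construct.Flip.EqAndOrd as Flip
import Relation.Binary.Construct.On as On
open import Relation.Binary.Core using (Rel)
open import Relation.Binary.Definitions using (tri<; tri≈; tri>)
import Relation.Binary.Definitions as B
open import Relation.Binary.PropositionalEquality
  using (_≡_; _≢_; refl; sym; trans; cong; subst; subst₂; isEquivalence)
open import Relation.Binary.Structures using (IsStrictTotalOrder; IsStrictPartialOrder)
open import Relation.Nullary using (¬_; yes; no)
open import Relation.Nullary.Decidable using (_×-dec_)
open import Relation.Unary using (Pred; Decidable)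

-- Well-founded descent on finite types and neighbouring indices.

finite-wellFounded : {A : Set} {_<_ : Rel A 0ℓ} → IsFinite A →
                     IsStrictPartialOrder _≡_ _<_ → WellFounded _<_
finite-wellFounded {_<_ = _<_} (_ , f) spo =
  Subrelation.wellFounded
    (λ {x} {y} → subst₂ _<_ (sym (strictlyInverseʳ x)) (sym (strictlyInverseʳ y)))
    (On.wellFounded to (Fin.spo-wellFounded (On.isStrictPartialOrder from spo)))
  where open Inverse f

-- Descent: as long as some smaller index satisfies `T`, move to it. With `<` this picks the least
-- index satisfying `T`, with the flipped order the greatest.
minimal : ∀ {n} {_⊏_ : Rel (Fin n) 0ℓ} → WellFounded _⊏_ → B.Decidable _⊏_ →
          {T : Pred (Fin n) 0ℓ} → Decidable T → ∃ T →
          ∃[ k ] T k × (∀ j → j ⊏ k → ¬ T j)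
minimal {_⊏_ = _⊏_} wf _⊏?_ {T} T? (m , t) = go m t (wf m)
  where
  go : ∀ m → T m → Acc _⊏_ m → ∃[ k ] T k × (∀ j → j ⊏ k → ¬ T j)
  go m t (acc rs) with Fin.any? (λ j → (j ⊏? m) ×-dec T? j)
  ... | yes (j , j⊏m , t′) = go j t′ (rs j⊏m)
  ... | no none            = m , t , λ j j⊏m t′ → none (j , j⊏m , t′)

-- The blocks are bounded only by adjacent indices; this supplies the neighbour from which the bound
-- spreads to every smaller index.
<⇒pred : ∀ {n} {j k : Fin n} → j Fin.< k →
         ∃[ k′ ] ℕ.suc (toℕ {n} k′) ≡ toℕ k × j Fin.≤ k′
<⇒pred {j = j} {suc k} (ℕ.s≤s j≤k) =
  Fin.inject₁ k , cong ℕ.suc (Fin.toℕ-inject₁ k) ,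
  subst (toℕ j ℕ.≤_) (sym (Fin.toℕ-inject₁ k)) j≤k

<⇒suc : ∀ {n} {j k : Fin n} → j Fin.< k →
        ∃[ j′ ] toℕ {n} j′ ≡ ℕ.suc (toℕ j) × j′ Fin.≤ k
<⇒suc {k = k} j<k = fromℕ< 1+j<n , eq , subst (ℕ._≤ toℕ k) (sym eq) j<k
  where
  1+j<n = ℕ.≤-<-trans j<k (Fin.toℕ<n k)
  eq    = Fin.toℕ-fromℕ< 1+j<n

-- Gaps of an increasing sequence in a strict total order.

module Gaps {A : Set} {_<_ : Rel A 0ℓ} (sto : IsStrictTotalOrder _≡_ _<_)
            {n} (c : Fin n → A) (c-mono : ∀ {j k} → j Fin.< k → c j < c k) where

  private module S = IsStrictTotalOrder sto

  -- For `c = o` and `c = i` these unfold to `Q` and `P`, so all results on gaps apply to the blocks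
  -- without conversion.
  GapBelow GapAbove : Fin n → Pred A 0ℓ
  GapBelow k e = (∀ j → ℕ.suc (toℕ j) ≡ toℕ k → c j < e) × e < c k
  GapAbove k e = c k < e × (∀ j → toℕ j ≡ ℕ.suc (toℕ k) → e < c j)

  <c-mono : ∀ {e j k} → j Fin.≤ k → e < c j → e < c k
  <c-mono j≤k e<cj with ℕ.m≤n⇒m<n∨m≡n j≤k
  ... | inj₁ j<k = S.trans e<cj (c-mono j<k)
  ... | inj₂ eq with refl ← Fin.toℕ-injective eq = e<cj

  c<-mono : ∀ {e j k} → j Fin.≤ k → c k < e → c j < e
  c<-mono j≤k ck<e with ℕ.m≤n⇒m<n∨m≡n j≤k
  ... | inj₁ j<k = S.trans (c-mono j<k) ck<e
  ... | inj₂ eq with refl ← Fin.toℕ-injective eq = ck<e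

  gapBelow-lower : ∀ {j k e} → GapBelow k e → j Fin.< k → c j < e
  gapBelow-lower (lower , _) j<k with <⇒pred j<k
  ... | k′ , eq , j≤k′ = c<-mono j≤k′ (lower k′ eq)

  gapAbove-upper : ∀ {j k e} → GapAbove j e → j Fin.< k → e < c k
  gapAbove-upper (_ , upper) j<k with <⇒suc j<k
  ... | j′ , eq , j′≤k = <c-mono j′≤k (upper j′ eq)

  -- For `j < k`, an element of both gaps would lie below `c j` by the first and above it by the
  -- second.
  gapBelow-unique : ∀ {j k e} → GapBelow j e → GapBelow k e → j ≡ k
  gapBelow-unique {j} {k} p q with Fin.<-cmp j k
  ... | tri< j<k _ _ = ⊥-elim (S.asym (proj₂ p) (gapBelow-lower q j<k))
  ... | tri≈ _ j≡k _ = j≡k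
  ... | tri> _ _ k<j = ⊥-elim (S.asym (proj₂ q) (gapBelow-lower p k<j))

  gapAbove-unique : ∀ {j k e} → GapAbove j e → GapAbove k e → j ≡ k
  gapAbove-unique {j} {k} p q with Fin.<-cmp j k
  ... | tri< j<k _ _ = ⊥-elim (S.asym (proj₁ q) (gapAbove-upper p j<k))
  ... | tri≈ _ j≡k _ = j≡k
  ... | tri> _ _ k<j = ⊥-elim (S.asym (proj₁ p) (gapAbove-upper q k<j))

  -- Take the least `k` with `e < c k`; by minimality, and since `e` is no value of `c`, the
  -- preceding value lies below `e`.
  gapBelow-cover : ∀ {e} → (∀ k → c k ≢ e) → (∃[ m ] e < c m) → ∃[ k ] GapBelow k e
  gapBelow-cover {e} off below
    with minimal Fin.<-wellFounded Fin._<?_ (λ k → e S.<? c k) below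
  ... | k , e<ck , least = k , lower , e<ck
    where
    lower : ∀ j → ℕ.suc (toℕ j) ≡ toℕ k → c j < e
    lower j eq with S.compare (c j) e
    ... | tri< cj<e _ _ = cj<e
    ... | tri≈ _ cj≡e _ = ⊥-elim (off j cj≡e)
    -- `j < k` unfolds to `suc (toℕ j) ≤ toℕ k`, which is `eq` weakened.
    ... | tri> _ _ e<cj = ⊥-elim (least j (ℕ.≤-reflexive eq) e<cj)

  gapAbove-cover : ∀ {e} → (∀ k → c k ≢ e) → (∃[ m ] c m < e) → ∃[ k ] GapAbove k e
  gapAbove-cover {e} off above
    with minimal Fin.>-wellFounded (flip Fin._<?_) (λ k → c k S.<? e) above
  ... | k , ck<e , greatest = k , ck<e , upper
    where
    upper : ∀ j → toℕ j ≡ ℕ.suc (toℕ k) → e < c j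
    upper j eq with S.compare (c j) e
    ... | tri< cj<e _ _ = ⊥-elim (greatest j (ℕ.≤-reflexive (sym eq)) cj<e)
    ... | tri≈ _ cj≡e _ = ⊥-elim (off j cj≡e)
    ... | tri> _ _ e<cj = e<cj

-- Paths, input edges and output edges in a single POP-graph.

module POPGraphProperties (H : POPGraph) where

  open POPGraph H
  module ≺ = IsStrictTotalOrder isStrictTotalOrder

  consecutive⇒≺ : ∀ {e e′} → Consecutive e e′ → e ≺ e′
  consecutive⇒≺ c = P1 ((λ { refl → acyclic ε c }) , c ◅ ε)

  path⇒≼ : ∀ {e e′} → Path e e′ → e ≡ e′ ⊎ e ≺ e′
  path⇒≼ {e} {e′} p with finite-≟ finiteE e e′
  ... | yes e≡e′ = inj₁ e≡e′
  ... | no  e≢e′ = inj₂ (P1 (e≢e′ , p))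

  -- This is (P2) with the inequality of edges dropped from `⟶`; asymmetry of `≺` recovers
  -- `e₁ ≢ e₃`.
  between-path : ∀ {e₁ e₂ e₃} → e₁ ≺ e₂ → e₂ ≺ e₃ → Path e₁ e₃ →
                 Path e₁ e₂ ⊎ Path e₂ e₃
  between-path l r p = Sum.map proj₂ proj₂
    (P2 l r ((λ { refl → ≺.asym l r }) , p))

  -- A following edge would give the boundary vertex an outgoing half-edge besides the incoming one,
  -- contradicting degree one.
  no-edge-after-output : ∀ {e e′} → IsOutput e → ¬ Consecutive e e′
  no-edge-after-output {e} {e′} out c
    with () ← card≡1⇒unique (finiteHalfEdge _) out (inj₁ (e′ , sym c)) (inj₂ (e , refl))

  no-edge-before-input : ∀ {e e′} → IsInput e′ → ¬ Consecutive e e′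
  no-edge-before-input {e} {e′} inp c
    with () ← card≡1⇒unique (finiteHalfEdge _) inp (inj₁ (e′ , refl)) (inj₂ (e , c))

  path-from-output : ∀ {e e′} → IsOutput e → Path e e′ → e ≡ e′
  path-from-output out ε       = refl
  path-from-output out (c ◅ _) = ⊥-elim (no-edge-after-output out c)

  path-to-input : ∀ {e e′} → IsInput e′ → Path e e′ → e ≡ e′
  path-to-input inp ε = refl
  path-to-input inp (c ◅ p) with refl ← path-to-input inp p =
    ⊥-elim (no-edge-before-input inp c)

  -- Keep following an outgoing edge. Each step ascends in `≺`, so finiteness stops the walk; where
  -- no edge leaves, the target is a sink and hence a boundary vertex.
  reaches-output : ∀ e → ∃[ e′ ] IsOutput e′ × Path e e′
  reaches-output e = go e (finite-wellFounded finiteE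
                             (Flip.isStrictPartialOrder ≺.isStrictPartialOrder) e)
    where
    go : ∀ e → Acc (flip _≺_) e → ∃[ e′ ] IsOutput e′ × Path e e′
    go e (acc rs)
      with isOutput? e | finite-any? finiteE (λ e′ → finite-≟ finiteV (src e′) (tgt e))
    ... | yes out | _ = e , out , ε
    ... | no ¬out | no none = ⊥-elim (¬out (sink-degree λ e′ eq → none (e′ , eq)))
    ... | no ¬out | yes (e′ , eq) with go e′ (rs (consecutive⇒≺ (sym eq)))
    ...   | e″ , out , p = e″ , out , sym eq ◅ p

  reached-from-input : ∀ e → ∃[ e′ ] IsInput e′ × Path e′ e
  reached-from-input e = go e (finite-wellFounded finiteE ≺.isStrictPartialOrder e)
    where
    go : ∀ e → Acc _≺_ e → ∃[ e′ ] IsInput e′ × Path e′ e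
    go e (acc rs)
      with isInput? e | finite-any? finiteE (λ e′ → finite-≟ finiteV (tgt e′) (src e))
    ... | yes inp | _ = e , inp , ε
    ... | no ¬inp | no none = ⊥-elim (¬inp (source-degree λ e′ eq → none (e′ , eq)))
    ... | no ¬inp | yes (e′ , eq) with go e′ (rs (consecutive⇒≺ eq))
    ...   | e″ , inp , p = e″ , inp , p ◅◅ (eq ◅ ε)

module CompositionProperties (H₁ H₂ : POPGraph) {n}
                             (outputs : POPGraph.SortedOutputs H₁ n)
                             (inputs  : POPGraph.SortedInputs  H₂ n) where

  private
    module G₁ where
      open POPGraph H₁ public
      open POPGraphProperties H₁ public
    module G₂ where
      open POPGraph H₂ public
      open POPGraphProperties H₂ public
    module O = SortedEnumeration outputs
    module I = SortedEnumeration inputs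

  open Composition H₁ H₂ outputs inputs

  module Gaps₁ = Gaps G₁.isStrictTotalOrder o O.increasing
  module Gaps₂ = Gaps G₂.isStrictTotalOrder i I.increasing

  -- The blocks cover the old edges and are joined to the new edges.

  o-output : ∀ k → G₁.IsOutput (o k)
  o-output k = proj₂ (O.at k)

  i-input : ∀ k → G₂.IsInput (i k)
  i-input k = proj₂ (I.at k)

  o-surjective : ∀ {e} → G₁.IsOutput e → ∃[ k ] o k ≡ e
  o-surjective out = let k , eq = O.surjective (_ , out) in k , cong proj₁ eq

  i-surjective : ∀ {e} → G₂.IsInput e → ∃[ k ] i k ≡ e
  i-surjective inp = let k , eq = I.surjective (_ , inp) in k , cong proj₁ eq

  no-path-between-outputs : ∀ {j k} → o j G₁.≺ o k → ¬ G₁.Path (o j) (o k)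
  no-path-between-outputs {j} lt p = G₁.≺.irrefl (G₁.path-from-output (o-output j) p) lt

  no-path-between-inputs : ∀ {j k} → i j G₂.≺ i k → ¬ G₂.Path (i j) (i k)
  no-path-between-inputs {k = k} lt p = G₂.≺.irrefl (G₂.path-to-input (i-input k) p) lt

  path-to-some-o : ∀ e → ∃[ m ] G₁.Path e (o m)
  path-to-some-o e with G₁.reaches-output e
  ... | _ , out , p with o-surjective out
  ...   | m , refl = m , p

  path-from-some-i : ∀ e → ∃[ m ] G₂.Path (i m) e
  path-from-some-i e with G₂.reached-from-input e
  ... | _ , inp , p with i-surjective inp
  ...   | m , refl = m , p

  Q-cover : ∀ {e} → ¬ G₁.IsOutput e → ∃[ k ] Q k e
  Q-cover {e} ¬out = Gaps₁.gapBelow-cover off below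
    where
    off : ∀ k → o k ≢ e
    off k refl = ¬out (o-output k)
    below : ∃[ m ] e G₁.≺ o m
    below with path-to-some-o e
    ... | m , p with G₁.path⇒≼ p
    ...   | inj₁ refl = ⊥-elim (off m refl)
    ...   | inj₂ lt   = m , lt

  P-cover : ∀ {e} → ¬ G₂.IsInput e → ∃[ k ] P k e
  P-cover {e} ¬inp = Gaps₂.gapAbove-cover off above
    where
    off : ∀ k → i k ≢ e
    off k refl = ¬inp (i-input k)
    above : ∃[ m ] i m G₂.≺ e
    above with path-from-some-i e
    ... | m , p with G₂.path⇒≼ p
    ...   | inj₁ refl = ⊥-elim (off m refl)
    ...   | inj₂ lt   = m , lt

  -- Some `o m` is reached from `e`. If `m < k`, then `o m` precedes `e`, against (P1). If `k < m`,
  -- (P2) applied to `e ≺ o k ≺ o m` leaves only a path to `o k`, as no path joins two outputs.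
  path-to-o : ∀ {k e} → Q k e → G₁.Path e (o k)
  path-to-o {k} {e} q with path-to-some-o e
  ... | m , p with Fin.<-cmp m k
  ...   | tri≈ _ refl _ = p
  ...   | tri< m<k _ _ with G₁.path⇒≼ p
  ...     | inj₁ refl = ⊥-elim (G₁.≺.irrefl refl (Gaps₁.gapBelow-lower q m<k))
  ...     | inj₂ lt   = ⊥-elim (G₁.≺.asym lt (Gaps₁.gapBelow-lower q m<k))
  path-to-o {k} {e} q | m , p | tri> _ _ k<m
    with G₁.between-path (proj₂ q) (O.increasing k<m) p
  ... | inj₁ p′ = p′
  ... | inj₂ p′ = ⊥-elim (no-path-between-outputs (O.increasing k<m) p′)

  path-from-i : ∀ {k e} → P k e → G₂.Path (i k) e
  path-from-i {k} {e} q with path-from-some-i e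
  ... | m , p with Fin.<-cmp k m
  ...   | tri≈ _ refl _ = p
  ...   | tri< k<m _ _ with G₂.path⇒≼ p
  ...     | inj₁ refl = ⊥-elim (G₂.≺.irrefl refl (Gaps₂.gapAbove-upper q k<m))
  ...     | inj₂ lt   = ⊥-elim (G₂.≺.asym lt (Gaps₂.gapAbove-upper q k<m))
  path-from-i {k} {e} q | m , p | tri> _ _ m<k
    with G₂.between-path (I.increasing m<k) (proj₁ q) p
  ... | inj₁ p′ = ⊥-elim (no-path-between-inputs (I.increasing m<k) p′)
  ... | inj₂ p′ = p′

  -- The composite order is a strict total order.

  module <ᵇ = IsStrictTotalOrder
    (×-isStrictTotalOrder (Fin.<-isStrictTotalOrder {n}) (Fin.<-isStrictTotalOrder {3}))

  block : ∀ x → ∃[ b ] x ∈Block b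
  block (old₁ e ¬out) = let k , q = Q-cover ¬out in (k , zero) , inQ q
  block (new k)       = (k , suc zero) , isNew
  block (old₂ e ¬in)  = let k , p = P-cover ¬in in (k , suc (suc zero)) , inP p

  -- Constructors fix the second component, uniqueness of gaps the first. It lets two derivations
  -- about the same edge be matched, as transitivity requires.
  block-unique : ∀ {x b c} → x ∈Block b → x ∈Block c → b ≡ c
  block-unique (inQ q) (inQ q′) = cong (_, zero) (Gaps₁.gapBelow-unique q q′)
  block-unique isNew   isNew    = refl
  block-unique (inP p) (inP p′) = cong (_, suc (suc zero)) (Gaps₂.gapAbove-unique p p′)

  ≺∘-irrefl : ∀ {x} → ¬ (x ≺∘ x)
  ≺∘-irrefl (between x∈b x∈c b<c) with refl ← block-unique x∈b x∈c =
    <ᵇ.irrefl (refl , refl) b<c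
  ≺∘-irrefl (withinQ _ _ lt) = G₁.≺.irrefl refl lt
  ≺∘-irrefl (withinP _ _ lt) = G₂.≺.irrefl refl lt

  ≺∘-trans : ∀ {x y z} → x ≺∘ y → y ≺∘ z → x ≺∘ z
  ≺∘-trans (between x∈b y∈c b<c) (between y∈c′ z∈d c<d)
    with refl ← block-unique y∈c y∈c′ = between x∈b z∈d (<ᵇ.trans b<c c<d)
  ≺∘-trans (between x∈b y∈c b<c) (withinQ q q′ _)
    with refl ← block-unique y∈c (inQ q) = between x∈b (inQ q′) b<c
  ≺∘-trans (between x∈b y∈c b<c) (withinP p p′ _)
    with refl ← block-unique y∈c (inP p) = between x∈b (inP p′) b<c
  ≺∘-trans (withinQ q q′ _) (between y∈b z∈c b<c)
    with refl ← block-unique y∈b (inQ q′) = between (inQ q) z∈c b<c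
  ≺∘-trans (withinP p p′ _) (between y∈b z∈c b<c)
    with refl ← block-unique y∈b (inP p′) = between (inP p) z∈c b<c
  ≺∘-trans (withinQ q q′ lt) (withinQ r r′ lt′)
    with refl ← Gaps₁.gapBelow-unique q′ r = withinQ q r′ (G₁.≺.trans lt lt′)
  ≺∘-trans (withinP p p′ lt) (withinP r r′ lt′)
    with refl ← Gaps₂.gapAbove-unique p′ r = withinP p r′ (G₂.≺.trans lt lt′)

  ≺∘-asym : ∀ {x y} → x ≺∘ y → ¬ (y ≺∘ x)
  ≺∘-asym x≺y y≺x = ≺∘-irrefl (≺∘-trans x≺y y≺x)

  ≺∘-connex : ∀ x y → x ≺∘ y ⊎ x ≡ y ⊎ y ≺∘ x
  ≺∘-connex x y with block x | block y
  ... | b , x∈b | c , y∈c with <ᵇ.compare b c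
  ...   | tri< b<c _ _ = inj₁ (between x∈b y∈c b<c)
  ...   | tri> _ _ c<b = inj₂ (inj₂ (between y∈c x∈b c<b))
  ...   | tri≈ _ (refl , refl) _ with x∈b | y∈c
  ...     | isNew | isNew = inj₂ (inj₁ refl)
  ...     | inQ {e = e} q | inQ {e = e′} q′ with G₁.≺.compare e e′
  ...       | tri< lt _ _   = inj₁ (withinQ q q′ lt)
  ...       | tri≈ _ refl _ = inj₂ (inj₁ refl)
  ...       | tri> _ _ gt   = inj₂ (inj₂ (withinQ q′ q gt))
  ≺∘-connex x y | b , _ | .b , _ | tri≈ _ (refl , refl) _ | inP {e = e} p | inP {e = e′} p′
    with G₂.≺.compare e e′
  ... | tri< lt _ _   = inj₁ (withinP p p′ lt)
  ... | tri≈ _ refl _ = inj₂ (inj₁ refl)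
  ... | tri> _ _ gt   = inj₂ (inj₂ (withinP p′ p gt))

  ≺∘-isStrictTotalOrder : IsStrictTotalOrder _≡_ _≺∘_
  ≺∘-isStrictTotalOrder = record
    { isStrictPartialOrder = record
      { isEquivalence = isEquivalence
      ; irrefl        = λ { refl → ≺∘-irrefl }
      ; trans         = ≺∘-trans
      ; <-resp-≈      = (λ { refl → id }) , (λ { refl → id })
      }
    ; compare = λ x y → tri (≺∘-connex x y)
    }
    where
    tri : ∀ {x y} → x ≺∘ y ⊎ x ≡ y ⊎ y ≺∘ x → B.Tri (x ≺∘ y) (x ≡ y) (y ≺∘ x)
    tri (inj₁ lt)          = tri< lt (λ { refl → ≺∘-irrefl lt }) (≺∘-asym lt)
    tri (inj₂ (inj₁ refl)) = tri≈ ≺∘-irrefl refl ≺∘-irrefl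
    tri (inj₂ (inj₂ gt))   = tri> (≺∘-asym gt) (λ { refl → ≺∘-irrefl gt }) gt

  -- Restriction of the composite order to lower and upper edges.

  infix 4 _↦₁_ _↦₂_
  -- Satisfiable only for lower edges; it treats old edges of `G₁` and new edges, seen as outputs,
  -- uniformly.
  _↦₁_ : Edge → G₁.E → Set
  x ↦₁ e = over₁ x ≡ inj₁ e

  _↦₂_ : Edge → G₂.E → Set
  x ↦₂ e = over₂ x ≡ inj₂ e

  ↦₁-surjective : ∀ e → ∃[ x ] x ↦₁ e
  ↦₁-surjective e with G₁.isOutput? e
  ... | no ¬out = old₁ e ¬out , refl
  ... | yes out = let k , eq = o-surjective out in new k , cong inj₁ eq

  ↦₂-surjective : ∀ e → ∃[ x ] x ↦₂ e
  ↦₂-surjective e with G₂.isInput? e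
  ... | no ¬in  = old₂ e ¬in , refl
  ... | yes inp = let k , eq = i-surjective inp in new k , cong inj₂ eq

  -- Dropping the `P` blocks leaves `Q₁, o₁, Q₂, o₂, …`, which is how `≺₁` lists the edges; equal
  -- first indices are settled by the tags in `Fin 3`.
  ≺∘⇒≺₁ : ∀ {x y e e′} → x ↦₁ e → y ↦₁ e′ → x ≺∘ y → e G₁.≺ e′
  ≺∘⇒≺₁ refl refl (between (inQ q) (inQ q′) (inj₁ lt)) =
    G₁.≺.trans (proj₂ q) (Gaps₁.gapBelow-lower q′ lt)
  ≺∘⇒≺₁ refl refl (between (inQ q) (inQ q′) (inj₂ (_ , ())))
  ≺∘⇒≺₁ refl refl (between (inQ q) isNew (inj₁ lt)) = Gaps₁.<c-mono (ℕ.<⇒≤ lt) (proj₂ q)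
  ≺∘⇒≺₁ refl refl (between (inQ q) isNew (inj₂ (refl , _))) = proj₂ q
  ≺∘⇒≺₁ refl refl (between isNew (inQ q) (inj₁ lt)) = Gaps₁.gapBelow-lower q lt
  ≺∘⇒≺₁ refl refl (between isNew (inQ q) (inj₂ (_ , ())))
  ≺∘⇒≺₁ refl refl (between isNew isNew (inj₁ lt)) = O.increasing lt
  ≺∘⇒≺₁ refl refl (between isNew isNew (inj₂ (_ , ℕ.s≤s ())))
  ≺∘⇒≺₁ refl refl (withinQ _ _ lt) = lt

  ≺∘⇒≺₂ : ∀ {x y e e′} → x ↦₂ e → y ↦₂ e′ → x ≺∘ y → e G₂.≺ e′
  ≺∘⇒≺₂ refl refl (between (inP p) (inP p′) (inj₁ lt)) =
    G₂.≺.trans (Gaps₂.gapAbove-upper p lt) (proj₁ p′)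
  ≺∘⇒≺₂ refl refl (between (inP p) (inP p′) (inj₂ (_ , ℕ.s≤s (ℕ.s≤s ()))))
  ≺∘⇒≺₂ refl refl (between (inP p) isNew (inj₁ lt)) = Gaps₂.gapAbove-upper p lt
  ≺∘⇒≺₂ refl refl (between (inP p) isNew (inj₂ (_ , ℕ.s≤s ())))
  ≺∘⇒≺₂ refl refl (between isNew (inP p) (inj₁ lt)) = Gaps₂.c<-mono (ℕ.<⇒≤ lt) (proj₁ p)
  ≺∘⇒≺₂ refl refl (between isNew (inP p) (inj₂ (refl , _))) = proj₁ p
  ≺∘⇒≺₂ refl refl (between isNew isNew (inj₁ lt)) = I.increasing lt
  ≺∘⇒≺₂ refl refl (between isNew isNew (inj₂ (_ , ℕ.s≤s ())))
  ≺∘⇒≺₂ refl refl (withinP _ _ lt) = lt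

  -- Converse of `≺∘⇒≺₁`: by connexity of `≺∘`, any other outcome would contradict `e ≺ e′` in `G₁`.
  ≺₁⇒≺∘ : ∀ {x y e e′} → x ↦₁ e → y ↦₁ e′ → e G₁.≺ e′ → x ≺∘ y
  ≺₁⇒≺∘ {x} {y} x↦ y↦ lt with ≺∘-connex x y
  ... | inj₁ x≺y         = x≺y
  ... | inj₂ (inj₁ refl) =
    ⊥-elim (G₁.≺.irrefl (inj₁-injective (trans (sym x↦) y↦)) lt)
  ... | inj₂ (inj₂ y≺x)  = ⊥-elim (G₁.≺.asym lt (≺∘⇒≺₁ y↦ x↦ y≺x))

  ≺₂⇒≺∘ : ∀ {x y e e′} → x ↦₂ e → y ↦₂ e′ → e G₂.≺ e′ → x ≺∘ y
  ≺₂⇒≺∘ {x} {y} x↦ y↦ lt with ≺∘-connex x y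
  ... | inj₁ x≺y         = x≺y
  ... | inj₂ (inj₁ refl) =
    ⊥-elim (G₂.≺.irrefl (inj₂-injective (trans (sym x↦) y↦)) lt)
  ... | inj₂ (inj₂ y≺x)  = ⊥-elim (G₂.≺.asym lt (≺∘⇒≺₂ y↦ x↦ y≺x))

  -- Transfer of paths between the composite and its factors.

  consecutive⁻ : ∀ {x y} → C.Consecutive x y →
    (∃[ e ] ∃[ e′ ] x ↦₁ e × y ↦₁ e′ × G₁.Consecutive e e′) ⊎
    (∃[ e ] ∃[ e′ ] x ↦₂ e × y ↦₂ e′ × G₂.Consecutive e e′)
  consecutive⁻ {old₁ _ _} {old₁ _ _} c =
    inj₁ (_ , _ , refl , refl , cong proj₁ (inj₁-injective c))
  consecutive⁻ {old₁ _ _} {new _}    c =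
    inj₁ (_ , _ , refl , refl , cong proj₁ (inj₁-injective c))
  consecutive⁻ {new _}    {old₂ _ _} c =
    inj₂ (_ , _ , refl , refl , cong proj₁ (inj₂-injective c))
  consecutive⁻ {old₂ _ _} {old₂ _ _} c =
    inj₂ (_ , _ , refl , refl , cong proj₁ (inj₂-injective c))
  consecutive⁻ {old₁ _ _} {old₂ _ _} ()
  consecutive⁻ {new _}    {old₁ _ _} ()
  consecutive⁻ {new _}    {new _}    ()
  consecutive⁻ {old₂ _ _} {old₁ _ _} ()
  consecutive⁻ {old₂ _ _} {new _}    ()

  consecutive₁⁺ : ∀ {x y e e′} → x ↦₁ e → y ↦₁ e′ → G₁.Consecutive e e′ → C.Consecutive x y
  consecutive₁⁺ {old₁ _ _} {old₁ _ _} refl refl c = cong inj₁ (Σ-≡ (λ _ _ → refl) c)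
  consecutive₁⁺ {old₁ _ _} {new _}    refl refl c = cong inj₁ (Σ-≡ (λ _ _ → refl) c)
  consecutive₁⁺ {new k}               refl _    c = ⊥-elim (G₁.no-edge-after-output (o-output k) c)

  consecutive₂⁺ : ∀ {x y e e′} → x ↦₂ e → y ↦₂ e′ → G₂.Consecutive e e′ → C.Consecutive x y
  consecutive₂⁺ {new _}    {old₂ _ _} refl refl c = cong inj₂ (Σ-≡ (λ _ _ → refl) c)
  consecutive₂⁺ {old₂ _ _} {old₂ _ _} refl refl c = cong inj₂ (Σ-≡ (λ _ _ → refl) c)
  consecutive₂⁺ {y = new k}           _    refl c = ⊥-elim (G₂.no-edge-before-input (i-input k) c)

  -- Every intermediate edge is lifted by `↦₁-surjective`; at the end of the path, injectivity of
  -- `over₁` identifies the two lifts.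
  path₁⁺ : ∀ {x y e e′} → x ↦₁ e → y ↦₁ e′ → G₁.Path e e′ → C.Path x y
  path₁⁺ x↦ y↦ ε with refl ← over₁-injective (trans x↦ (sym y↦)) = ε
  path₁⁺ x↦ y↦ (c ◅ p) =
    let _ , z↦ = ↦₁-surjective _ in consecutive₁⁺ x↦ z↦ c ◅ path₁⁺ z↦ y↦ p

  path₂⁺ : ∀ {x y e e′} → x ↦₂ e → y ↦₂ e′ → G₂.Path e e′ → C.Path x y
  path₂⁺ x↦ y↦ ε with refl ← over₂-injective (trans x↦ (sym y↦)) = ε
  path₂⁺ x↦ y↦ (c ◅ p) =
    let _ , z↦ = ↦₂-surjective _ in consecutive₂⁺ x↦ z↦ c ◅ path₂⁺ z↦ y↦ p

  -- New edges and old edges of `G₂` end at a vertex of `G₂`, where no lower edge starts, so a path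
  -- ending at a lower edge has only lower edges.
  path₁⁻ : ∀ {x y e′} → y ↦₁ e′ → C.Path x y → ∃[ e ] x ↦₁ e × G₁.Path e e′
  path₁⁻ y↦ ε = _ , y↦ , ε
  path₁⁻ y↦ (_◅_ {i = x} {j = z} c p) with x | z | path₁⁻ y↦ p
  ... | old₁ _ _ | old₁ _ _ | _ , refl , q = _ , refl , cong proj₁ (inj₁-injective c) ◅ q
  ... | old₁ _ _ | new _    | _ , refl , q = _ , refl , cong proj₁ (inj₁-injective c) ◅ q
  ... | new _    | old₁ _ _ | _ , refl , _ with () ← c
  ... | new _    | new _    | _ , refl , _ with () ← c
  ... | old₂ _ _ | old₁ _ _ | _ , refl , _ with () ← c
  ... | old₂ _ _ | new _    | _ , refl , _ with () ← c

  path₂⁻ : ∀ {x y e} → x ↦₂ e → C.Path x y → ∃[ e′ ] y ↦₂ e′ × G₂.Path e e′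
  path₂⁻ x↦ ε = _ , x↦ , ε
  path₂⁻ {old₁ _ _} () (_ ◅ _)
  path₂⁻ {new _}    x↦   (_◅_ {j = old₁ _ _} () p)
  path₂⁻ {old₂ _ _} x↦   (_◅_ {j = old₁ _ _} () p)
  path₂⁻ {new _}    x↦   (_◅_ {j = new _} () p)
  path₂⁻ {old₂ _ _} x↦   (_◅_ {j = new _} () p)
  path₂⁻ {new _}    refl (_◅_ {j = old₂ _ _} c p) with path₂⁻ refl p
  ... | _ , y↦ , q = _ , y↦ , cong proj₁ (inj₂-injective c) ◅ q
  path₂⁻ {old₂ _ _} refl (_◅_ {j = old₂ _ _} c p) with path₂⁻ refl p
  ... | _ , y↦ , q = _ , y↦ , cong proj₁ (inj₂-injective c) ◅ q

  consecutive⇒≺∘ : ∀ {x y} → C.Consecutive x y → x ≺∘ y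
  consecutive⇒≺∘ {x} {y} c with consecutive⁻ {x} {y} c
  ... | inj₁ (_ , _ , x↦ , y↦ , d) = ≺₁⇒≺∘ x↦ y↦ (G₁.consecutive⇒≺ d)
  ... | inj₂ (_ , _ , x↦ , y↦ , d) = ≺₂⇒≺∘ x↦ y↦ (G₂.consecutive⇒≺ d)

  path⇒≼∘ : ∀ {x y} → C.Path x y → x ≡ y ⊎ x ≺∘ y
  path⇒≼∘ ε = inj₁ refl
  path⇒≼∘ (_◅_ {i = x} {j = z} c p) with path⇒≼∘ p
  ... | inj₁ refl = inj₂ (consecutive⇒≺∘ {x} {z} c)
  ... | inj₂ lt   = inj₂ (≺∘-trans (consecutive⇒≺∘ {x} {z} c) lt)

  -- Crossing from `G₁` to `G₂`, and replacing an edge by the new edge of its block.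

  crossing : ∀ {e ¬out e′ ¬in} → C.Path (old₁ e ¬out) (old₂ e′ ¬in) →
             ∃[ k ] C.Path (old₁ e ¬out) (new k) × C.Path (new k) (old₂ e′ ¬in)
  crossing (_◅_ {j = old₁ _ _} c p) = let k , q , r = crossing p in k , c ◅ q , r
  crossing (_◅_ {j = new k}    c p) = k , c ◅ ε , p

  no-path-new-new : ∀ {j k} → new j ≺∘ new k → ¬ C.Path (new j) (new k)
  no-path-new-new lt p with path₁⁻ refl p
  ... | _ , refl , q = no-path-between-outputs (≺∘⇒≺₁ refl refl lt) q

  no-path-new-old₁ : ∀ {j e ¬out} → ¬ C.Path (new j) (old₁ e ¬out)
  no-path-new-old₁ p with path-to-old₁ p
  ... | _ , _ , () , _

  no-path-old₂-new : ∀ {k e ¬in} → ¬ C.Path (old₂ e ¬in) (new k)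
  no-path-old₂-new p with path-from-old₂ p
  ... | _ , _ , () , _

  -- An old edge of `G₂` after block `(j , 0)` lies in block `(j , 2)` or later, hence after `new j`
  -- in block `(j , 1)`.
  Q-new-mono : ∀ {j e ¬out e′ ¬in} → Q j e →
               old₁ e ¬out ≺∘ old₂ e′ ¬in → new j ≺∘ old₂ e′ ¬in
  Q-new-mono q (between y∈b z∈c b<c) with block-unique y∈b (inQ q)
  Q-new-mono q (between _ (inP p) (inj₁ lt))         | refl = between isNew (inP p) (inj₁ lt)
  Q-new-mono q (between _ (inP p) (inj₂ (refl , _))) | refl =
    between isNew (inP p) (inj₂ (refl , ℕ.s≤s (ℕ.s≤s ℕ.z≤n)))

  new-P-mono : ∀ {j e ¬in e′ ¬out} → P j e →
               old₁ e′ ¬out ≺∘ old₂ e ¬in → old₁ e′ ¬out ≺∘ new j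
  new-P-mono p (between x∈b y∈c b<c) with block-unique y∈c (inP p)
  new-P-mono p (between (inQ q) _ (inj₁ lt))         | refl = between (inQ q) isNew (inj₁ lt)
  new-P-mono p (between (inQ q) _ (inj₂ (refl , _))) | refl =
    between (inQ q) isNew (inj₂ (refl , ℕ.s≤s ℕ.z≤n))

  -- Unfolding Q-cover and P-cover makes the with-abstractions below blow up.
  abstract
    new-above : ∀ e ¬out → ∃[ j ] old₁ e ¬out ≺∘ new j × C.Path (old₁ e ¬out) (new j) ×
                (∀ {e′ ¬in} → old₁ e ¬out ≺∘ old₂ e′ ¬in → new j ≺∘ old₂ e′ ¬in)
    new-above e ¬out =
      let j , q = Q-cover ¬out
      in j , ≺₁⇒≺∘ refl refl (proj₂ q) , path₁⁺ refl refl (path-to-o q) , Q-new-mono q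

    new-below : ∀ e ¬in → ∃[ j ] new j ≺∘ old₂ e ¬in × C.Path (new j) (old₂ e ¬in) ×
                (∀ {e′ ¬out} → old₁ e′ ¬out ≺∘ old₂ e ¬in → old₁ e′ ¬out ≺∘ new j)
    new-below e ¬in =
      let j , p = P-cover ¬in
      in j , ≺₂⇒≺∘ refl refl (proj₁ p) , path₂⁺ refl refl (path-from-i p) , new-P-mono p

  -- (P2) in the composite.

  -- Since `z` is lower, so is the start `x` of the path; all three edges then live in `G₁`, where
  -- (P2) applies.
  between₁ : ∀ {x y z e₂ e₃} → y ↦₁ e₂ → z ↦₁ e₃ →
             x ≺∘ y → y ≺∘ z → C.Path x z → C.Path x y ⊎ C.Path y z
  between₁ y↦ z↦ x≺y y≺z p with path₁⁻ z↦ p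
  ... | _ , x↦ , q = Sum.map (path₁⁺ x↦ y↦) (path₁⁺ y↦ z↦)
    (G₁.between-path (≺∘⇒≺₁ x↦ y↦ x≺y) (≺∘⇒≺₁ y↦ z↦ y≺z) q)

  between₂ : ∀ {x y z e₁ e₂} → x ↦₂ e₁ → y ↦₂ e₂ →
             x ≺∘ y → y ≺∘ z → C.Path x z → C.Path x y ⊎ C.Path y z
  between₂ x↦ y↦ x≺y y≺z p with path₂⁻ x↦ p
  ... | _ , z↦ , q = Sum.map (path₂⁺ x↦ y↦) (path₂⁺ y↦ z↦)
    (G₂.between-path (≺∘⇒≺₂ x↦ y↦ x≺y) (≺∘⇒≺₂ y↦ z↦ y≺z) q)

  path-to-new : ∀ {e ¬out j k} → old₁ e ¬out ≺∘ new j → new j ≺∘ new k →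
                C.Path (old₁ e ¬out) (new k) → C.Path (old₁ e ¬out) (new j)
  path-to-new l r p with between₁ refl refl l r p
  ... | inj₁ q = q
  ... | inj₂ q = ⊥-elim (no-path-new-new r q)

  path-from-new : ∀ {e ¬in j k} → new j ≺∘ new k → new k ≺∘ old₂ e ¬in →
                  C.Path (new j) (old₂ e ¬in) → C.Path (new k) (old₂ e ¬in)
  path-from-new l r p with between₂ refl refl l r p
  ... | inj₁ q = ⊥-elim (no-path-new-new l q)
  ... | inj₂ q = q

  -- The place of `y` relative to the crossing edge `new k` decides which half of the path is
  -- compared with `y`: the half up to `new k` if `y` precedes it, the half from `new k` otherwise.
  between-via-new : ∀ {e ¬out e′ ¬in k} y → old₁ e ¬out ≺∘ y → y ≺∘ old₂ e′ ¬in →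
    C.Path (old₁ e ¬out) (new k) → C.Path (new k) (old₂ e′ ¬in) →
    C.Path (old₁ e ¬out) y ⊎ C.Path y (old₂ e′ ¬in)
  between-via-new {k = k} y x≺y y≺z q r with ≺∘-connex y (new k)
  between-via-new y            x≺y y≺z q r | inj₂ (inj₁ refl) = inj₁ q
  between-via-new (new _)      x≺y y≺z q r | inj₁ lt          = inj₁ (path-to-new x≺y lt q)
  between-via-new (new _)      x≺y y≺z q r | inj₂ (inj₂ gt)   = inj₂ (path-from-new gt y≺z r)
  between-via-new (old₁ _ _)   x≺y y≺z q r | inj₁ lt          =
    Sum.map₂ (_◅◅ r) (between₁ refl refl x≺y lt q)
  -- Here `y` lies in `G₁` but the relevant half of the path ends in `G₂`; the new edge `j` of its
  -- block lies between `new k` and the end of the path, so it leads to that end, and `y` leads to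
  -- it.
  between-via-new (old₁ f ¬f)  x≺y y≺z q r | inj₂ (inj₂ gt) with new-above f ¬f
  ... | _ , y≺j , y⟶j , bound =
    inj₂ (y⟶j ◅◅ path-from-new (≺∘-trans gt y≺j) (bound y≺z) r)
  between-via-new (old₂ f ¬f)  x≺y y≺z q r | inj₁ lt with new-below f ¬f
  ... | _ , j≺y , j⟶y , bound =
    inj₁ (path-to-new (bound x≺y) (≺∘-trans j≺y lt) q ◅◅ j⟶y)
  between-via-new (old₂ _ _)   x≺y y≺z q r | inj₂ (inj₂ gt)   =
    Sum.map₁ (q ◅◅_) (between₂ refl refl gt y≺z r)

  -- Paths from `G₁` to `G₂` are split at a crossing edge. Otherwise `y` and `z` are both lower, or
  -- `x` and `y` both upper, or `y` is off the side of the path and gives way to the new edge of its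
  -- block.
  between-path : ∀ x y z → x ≺∘ y → y ≺∘ z → C.Path x z → C.Path x y ⊎ C.Path y z
  between-path (old₁ _ _) y (old₂ _ _) x≺y y≺z p =
    let _ , q , r = crossing p in between-via-new y x≺y y≺z q r
  between-path x (old₁ _ _) (old₁ _ _) x≺y y≺z p = between₁ refl refl x≺y y≺z p
  between-path x (old₁ _ _) (new _)    x≺y y≺z p = between₁ refl refl x≺y y≺z p
  between-path x (new _)    (old₁ _ _) x≺y y≺z p = between₁ refl refl x≺y y≺z p
  between-path x (new _)    (new _)    x≺y y≺z p = between₁ refl refl x≺y y≺z p
  between-path (new _)    (new _)    z x≺y y≺z p = between₂ refl refl x≺y y≺z p
  between-path (new _)    (old₂ _ _) z x≺y y≺z p = between₂ refl refl x≺y y≺z p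
  between-path (old₂ _ _) (new _)    z x≺y y≺z p = between₂ refl refl x≺y y≺z p
  between-path (old₂ _ _) (old₂ _ _) z x≺y y≺z p = between₂ refl refl x≺y y≺z p
  between-path (old₁ _ _) (old₂ f ¬f) (new _) x≺y y≺z p =
    let _ , j≺y , j⟶y , bound = new-below f ¬f
    in inj₁ (path-to-new (bound x≺y) (≺∘-trans j≺y y≺z) p ◅◅ j⟶y)
  between-path (old₁ _ _) (old₂ f ¬f) (old₁ _ _) x≺y y≺z p
    with new-below f ¬f
  ... | j , j≺y , j⟶y , bound
    with between₁ refl refl (bound x≺y) (≺∘-trans j≺y y≺z) p
  ...   | inj₁ q = inj₁ (q ◅◅ j⟶y)
  -- A new edge cannot lead back into `G₁`, so only a path from `x` to `new j` remains.
  ...   | inj₂ q = ⊥-elim (no-path-new-old₁ q)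
  between-path (new _) (old₁ f ¬f) (old₂ _ _) x≺y y≺z p =
    let j , y≺j , y⟶j , bound = new-above f ¬f
    in inj₂ (y⟶j ◅◅ path-from-new (≺∘-trans x≺y y≺j) (bound y≺z) p)
  between-path (old₂ _ _) (old₁ f ¬f) (old₂ _ _) x≺y y≺z p
    with new-above f ¬f
  ... | j , y≺j , y⟶j , bound
    with between₂ refl refl (≺∘-trans x≺y y≺j) (bound y≺z) p
  ...   | inj₁ q = ⊥-elim (no-path-old₂-new q)
  ...   | inj₂ q = inj₂ (y⟶j ◅◅ q)

  isPlanarOrder : IsPlanarOrder composite _≺∘_
  isPlanarOrder = record
    { isStrictTotalOrder = ≺∘-isStrictTotalOrder
    ; P1 = λ { (x≢y , p) → Sum.fromInj₂ (⊥-elim ∘ x≢y) (path⇒≼∘ p) }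
    ; P2 = λ { {x} {y} {z} x≺y y≺z (_ , p) →
               Sum.map (≺⇒≢ x≺y ,_) (≺⇒≢ y≺z ,_) (between-path x y z x≺y y≺z p) }
    }
    where
    ≺⇒≢ : ∀ {x y} → x ≺∘ y → x ≢ y
    ≺⇒≢ lt refl = ≺∘-irrefl lt

theorem2p2 : (P₁ P₂ : POPGraph)
    (eq : POPGraph.numOutputs P₁ ≡ POPGraph.numInputs P₂) →
    IsPlanarOrder (compositeGraph P₂ P₁ eq) (compositeOrder P₂ P₁ eq)
theorem2p2 P₁ P₂ eq = CompositionProperties.isPlanarOrder P₁ P₂
  (POPGraph.sortedOutputs P₁)
  (subst (POPGraph.SortedInputs P₂) (sym eq) (POPGraph.sortedInputs P₂))
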